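{- Let $G=(V,E,w)$ be a finite connected graph with $|V|=n\ge2$ and weights $w:E\to\mathbb{R}_{>0}$. Define $$\Gamma(G)=\max_{\substack{S\subseteq V,\ |S|\ge2\\ G[S]\text{ connected}}}\frac{|S|-1}{\operatorname{diam}_{d_G}(S)}.$$ Then $$\operatorname{OPT}_{\mathrm{card}}(G,w)\le\Gamma(G)\,\operatorname{OPT}_{\mathrm{free}}(G,w).$$
   Context: $d_G$ is the shortest-path metric of $(V,E)$ with every edge of length $1$ (weights are not lengths); $\operatorname{diam}_{d_G}(S)=\max_{a,b\in S}d_G(a,b)$. $\operatorname{OPT}_{\mathrm{free}}(G,w)$ is the minimum of $\sum_{xy\in E}w_{xy}u(x,y)$ over all ultrametrics $u$ on $V$ (metrics with $u(x,y)\le\max\{u(x,z),u(z,y)\}$) with $u\ge d_G$ on all pairs. A rooted binary hierarchy $H$ on $V$ is a rooted tree whose leaves are the vertices of $V$ and whose internal nodes have exactly two children; $C_H(x,y)$ is the set of leaves below the lowest common ancestor of $x,y$; $h_H(x,x)=0$ and $h_H(x,y)=|C_H(x,y)|-1$ for $x\ne y$. $\operatorname{OPT}_{\mathrm{card}}(G,w)$ is the minimum of $\sum_{xy\in E}w_{xy}h_H(x,y)$ over all rooted binary hierarchies $H$ on $V$ with $h_H\ge d_G$ on all pairs. -}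

module Defs where

open import Level using (0ℓ; _⊔_)
open import Data.Bool.Base using (if_then_else_)
open import Data.Empty using (⊥-elim)
open import Data.Fin.Base as Fin using (Fin; zero; suc)
import Data.Fin.Properties as Finₚ
open import Data.Fin.Subset using (Subset; _∈_; ∣_∣; inside; outside)
open import Data.Fin.Subset.Properties using (_∈?_)
open import Data.Integer.Base using (+_)
open import Data.List.Base using (List; []; _∷_; length; allFin)
open import Data.List.Relation.Binary.Permutation.Propositional using (_↭_)
open import Data.Nat.Base as ℕ using (ℕ; zero; suc; z≤n; s≤s)
import Data.Nat.Properties as ℕₚ
open import Data.Product.Base using (∃; ∃-syntax; _×_; _,_; proj₁; proj₂)
open import Data.Rational.Base as ℚ using (ℚ; 0ℚ; 1ℚ; ½)
import Data.Rational.Properties as ℚₚ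
open import Data.Rational.Solver using (module +-*-Solver)
open import Data.Sum.Base using (inj₁; inj₂)
open import Data.Tree.Binary using (Tree; leaf; node; module Leaves)
open import Data.Unit.Base using (⊤)
open import Data.Vec.Base as Vec using ([]; _∷_)
import Data.Vec.Functional as Vector
import Data.List.Membership.DecPropositional as DecMembership
import Function.Metric.Structures as Metric
open import Relation.Binary.Core using (Rel)
open import Relation.Binary.Definitions using (Decidable; Symmetric; Irreflexive)
open import Relation.Binary.PropositionalEquality
  using (_≡_; _≢_; refl; sym; trans; cong; subst; subst₂)
open import Relation.Nullary using (Dec; yes; no; does)
open import Relation.Nullary.Decidable using (_×-dec_; map′)
open import Relation.Unary using (Pred)

IsCauchy : (ℕ → ℚ) → Set
IsCauchy s = ∀ ε → 0ℚ ℚ.< ε →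
  ∃[ N ] ∀ m n → N ℕ.≤ m → N ℕ.≤ n → ℚ.∣ s m ℚ.- s n ∣ ℚ.≤ ε

-- Cauchy sequences of rationals, to be compared with _≈ℝ_.
record ℝ : Set where
  constructor mkℝ
  field
    seq    : ℕ → ℚ
    cauchy : IsCauchy seq

open ℝ public

infix  4 _≤ℝ_ _<ℝ_ _≈ℝ_
infixl 6 _+ℝ_ _⊔ℝ_
infixl 7 _*ℝ_

_≤ℝ_ : Rel ℝ 0ℓ
x ≤ℝ y = ∀ ε → 0ℚ ℚ.< ε → ∃[ N ] ∀ n → N ℕ.≤ n → seq x n ℚ.≤ seq y n ℚ.+ ε

_<ℝ_ : Rel ℝ 0ℓ
x <ℝ y = ∃[ ε ] 0ℚ ℚ.< ε × ∃[ N ] ∀ n → N ℕ.≤ n → seq x n ℚ.+ ε ℚ.≤ seq y n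

_≈ℝ_ : Rel ℝ 0ℓ
x ≈ℝ y = x ≤ℝ y × y ≤ℝ x

0<½* : ∀ {ε} → 0ℚ ℚ.< ε → 0ℚ ℚ.< ½ ℚ.* ε
0<½* {ε} 0<ε = ℚₚ.positive⁻¹ (½ ℚ.* ε) {{ℚₚ.pos*pos⇒pos ½ ε {{ℚ.positive 0<ε}}}}

½+½ : ∀ ε → ½ ℚ.* ε ℚ.+ ½ ℚ.* ε ≡ ε
½+½ ε = trans (sym (ℚₚ.*-distribʳ-+ ε ½ ½)) (ℚₚ.*-identityˡ ε)

p≤∣p∣ : ∀ p → p ℚ.≤ ℚ.∣ p ∣
p≤∣p∣ p with ℚₚ.≤-total 0ℚ p
... | inj₁ 0≤p = ℚₚ.≤-reflexive (sym (ℚₚ.0≤p⇒∣p∣≡p 0≤p))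
... | inj₂ p≤0 = ℚₚ.≤-trans p≤0 (ℚₚ.0≤∣p∣ p)

∣-∣≤⇒≤+ : ∀ p q {ε} → ℚ.∣ p ℚ.- q ∣ ℚ.≤ ε → p ℚ.≤ q ℚ.+ ε
∣-∣≤⇒≤+ p q {ε} h = subst (ℚ._≤ q ℚ.+ ε)
  (solve 2 (λ p q → q :+ (p :- q) := p) refl p q)
  (ℚₚ.+-monoʳ-≤ q (ℚₚ.≤-trans (p≤∣p∣ (p ℚ.- q)) h))
  where open +-*-Solver

≤+⇒-≤ : ∀ p q {ε} → p ℚ.≤ q ℚ.+ ε → p ℚ.- q ℚ.≤ ε
≤+⇒-≤ p q {ε} h = subst (p ℚ.- q ℚ.≤_)
  (solve 2 (λ q ε → (q :+ ε) :- q := ε) refl q ε)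
  (ℚₚ.+-monoˡ-≤ (ℚ.- q) h)
  where open +-*-Solver

≤+⇒∣-∣≤ : ∀ p q {ε} → p ℚ.≤ q ℚ.+ ε → q ℚ.≤ p ℚ.+ ε → ℚ.∣ p ℚ.- q ∣ ℚ.≤ ε
≤+⇒∣-∣≤ p q {ε} h k with ℚₚ.∣p∣≡p∨∣p∣≡-p (p ℚ.- q)
... | inj₁ eq = subst (ℚ._≤ ε) (sym eq) (≤+⇒-≤ p q h)
... | inj₂ eq = subst (ℚ._≤ ε)
  (trans (solve 2 (λ p q → q :- p := :- (p :- q)) refl p q) (sym eq)) (≤+⇒-≤ q p k)
  where open +-*-Solver

⊔-≤+ : ∀ a b c d {ε} → a ℚ.≤ c ℚ.+ ε → b ℚ.≤ d ℚ.+ ε → a ℚ.⊔ b ℚ.≤ c ℚ.⊔ d ℚ.+ ε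
⊔-≤+ a b c d {ε} h k = ℚₚ.⊔-lub
  (ℚₚ.≤-trans h (ℚₚ.+-monoˡ-≤ ε (ℚₚ.p≤p⊔q c d)))
  (ℚₚ.≤-trans k (ℚₚ.+-monoˡ-≤ ε (ℚₚ.p≤q⊔p c d)))

abstract
  bounded : ∀ s → IsCauchy s →
            ∃[ B ] ℚ.Positive B × ∃[ N ] ∀ n → N ℕ.≤ n → ℚ.∣ s n ∣ ℚ.≤ B
  bounded s c with c 1ℚ (ℚₚ.positive⁻¹ 1ℚ)
  ... | N , h = ℚ.∣ s N ∣ ℚ.+ 1ℚ
      , ℚₚ.nonNeg+pos⇒pos ℚ.∣ s N ∣ {{ℚₚ.∣-∣-nonNeg (s N)}} 1ℚ
      , N , bound
    where
    open +-*-Solver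
    bound : ∀ n → N ℕ.≤ n → ℚ.∣ s n ∣ ℚ.≤ ℚ.∣ s N ∣ ℚ.+ 1ℚ
    bound n N≤n = subst (λ t → ℚ.∣ t ∣ ℚ.≤ ℚ.∣ s N ∣ ℚ.+ 1ℚ)
      (solve 2 (λ p q → q :+ (p :- q) := p) refl (s n) (s N))
      (ℚₚ.≤-trans (ℚₚ.∣p+q∣≤∣p∣+∣q∣ (s N) (s n ℚ.- s N))
                  (ℚₚ.+-monoʳ-≤ ℚ.∣ s N ∣ (h n N N≤n ℕₚ.≤-refl)))

  -- δ = ½ ε / B
  scale : ∀ B → ℚ.Positive B → ∀ ε → 0ℚ ℚ.< ε → ∃[ δ ] 0ℚ ℚ.< δ × B ℚ.* δ ≡ ½ ℚ.* ε
  scale B B>0 ε 0<ε = δ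
    , ℚₚ.positive⁻¹ δ {{ℚₚ.pos*pos⇒pos B⁻¹ {{ℚₚ.1/pos⇒pos B {{B>0}}}} (½ ℚ.* ε) {{ℚ.positive (0<½* 0<ε)}}}}
    , trans (sym (ℚₚ.*-assoc B B⁻¹ (½ ℚ.* ε)))
        (trans (cong (ℚ._* (½ ℚ.* ε)) (ℚₚ.*-inverseʳ B {{B≢0}})) (ℚₚ.*-identityˡ (½ ℚ.* ε)))
    where
    B≢0 : ℚ.NonZero B
    B≢0 = ℚₚ.pos⇒nonZero B {{B>0}}
    B⁻¹ : ℚ
    B⁻¹ = ℚ.1/_ B {{B≢0}}
    δ : ℚ
    δ = B⁻¹ ℚ.* (½ ℚ.* ε)

*-bound : ∀ p q B δ η → ℚ.Positive B → B ℚ.* δ ≡ η →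
          ℚ.∣ p ∣ ℚ.≤ B → ℚ.∣ q ∣ ℚ.≤ δ → ℚ.∣ p ℚ.* q ∣ ℚ.≤ η
*-bound p q B δ η B>0 refl hp hq = subst (ℚ._≤ B ℚ.* δ) (sym (ℚₚ.∣p*q∣≡∣p∣*∣q∣ p q))
  (ℚₚ.≤-trans
    (ℚₚ.*-monoʳ-≤-nonNeg ℚ.∣ q ∣ {{ℚₚ.∣-∣-nonNeg q}} hp)
    (ℚₚ.*-monoˡ-≤-nonNeg B {{ℚₚ.pos⇒nonNeg B {{B>0}}}} hq))

*-diff : ∀ a b c d → a ℚ.* (b ℚ.- d) ℚ.+ d ℚ.* (a ℚ.- c) ≡ a ℚ.* b ℚ.- c ℚ.* d
*-diff = solve 4 (λ a b c d → a :* (b :- d) :+ d :* (a :- c) := a :* b :- c :* d) refl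
  where open +-*-Solver

*-close : ∀ a b c d {B C δ η ε} →
          ℚ.Positive B → B ℚ.* δ ≡ ½ ℚ.* ε → ℚ.Positive C → C ℚ.* η ≡ ½ ℚ.* ε →
          ℚ.∣ a ∣ ℚ.≤ B → ℚ.∣ b ℚ.- d ∣ ℚ.≤ δ → ℚ.∣ d ∣ ℚ.≤ C → ℚ.∣ a ℚ.- c ∣ ℚ.≤ η →
          ℚ.∣ a ℚ.* b ℚ.- c ℚ.* d ∣ ℚ.≤ ε
*-close a b c d {B} {C} {δ} {η} {ε} B>0 Bδ C>0 Cη ha hbd hd hac =
  subst₂ (λ p q → ℚ.∣ p ∣ ℚ.≤ q) (*-diff a b c d) (½+½ ε)
    (ℚₚ.≤-trans (ℚₚ.∣p+q∣≤∣p∣+∣q∣ (a ℚ.* (b ℚ.- d)) (d ℚ.* (a ℚ.- c)))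
      (ℚₚ.+-mono-≤ (*-bound a (b ℚ.- d) B δ _ B>0 Bδ ha hbd)
                   (*-bound d (a ℚ.- c) C η _ C>0 Cη hd hac)))

abstract
  +-cauchy : ∀ s t → IsCauchy s → IsCauchy t → IsCauchy (λ n → s n ℚ.+ t n)
  +-cauchy s t cs ct ε 0<ε with cs (½ ℚ.* ε) (0<½* 0<ε) | ct (½ ℚ.* ε) (0<½* 0<ε)
  ... | M , h | N , k = M ℕ.⊔ N , λ m n hm hn → subst₂ (λ a b → ℚ.∣ a ∣ ℚ.≤ b)
      (solve 4 (λ a b c d → (a :- c) :+ (b :- d) := (a :+ b) :- (c :+ d)) refl (s m) (t m) (s n) (t n))
      (½+½ ε)
      (ℚₚ.≤-trans (ℚₚ.∣p+q∣≤∣p∣+∣q∣ (s m ℚ.- s n) (t m ℚ.- t n))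
        (ℚₚ.+-mono-≤
          (h m n (ℕₚ.m⊔n≤o⇒m≤o M N hm) (ℕₚ.m⊔n≤o⇒m≤o M N hn))
          (k m n (ℕₚ.m⊔n≤o⇒n≤o M N hm) (ℕₚ.m⊔n≤o⇒n≤o M N hn))))
    where open +-*-Solver

  ⊔-cauchy : ∀ s t → IsCauchy s → IsCauchy t → IsCauchy (λ n → s n ℚ.⊔ t n)
  ⊔-cauchy s t cs ct ε 0<ε with cs ε 0<ε | ct ε 0<ε
  ... | M , h | N , k = M ℕ.⊔ N , λ m n hm hn →
    let hm₁ = ℕₚ.m⊔n≤o⇒m≤o M N hm ; hn₁ = ℕₚ.m⊔n≤o⇒m≤o M N hn
        hm₂ = ℕₚ.m⊔n≤o⇒n≤o M N hm ; hn₂ = ℕₚ.m⊔n≤o⇒n≤o M N hn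
    in ≤+⇒∣-∣≤ (s m ℚ.⊔ t m) (s n ℚ.⊔ t n)
      (⊔-≤+ (s m) (t m) (s n) (t n) (∣-∣≤⇒≤+ (s m) (s n) (h m n hm₁ hn₁)) (∣-∣≤⇒≤+ (t m) (t n) (k m n hm₂ hn₂)))
      (⊔-≤+ (s n) (t n) (s m) (t m) (∣-∣≤⇒≤+ (s n) (s m) (h n m hn₁ hm₁)) (∣-∣≤⇒≤+ (t n) (t m) (k n m hn₂ hm₂)))

  *-cauchy : ∀ s t → IsCauchy s → IsCauchy t → IsCauchy (λ n → s n ℚ.* t n)
  *-cauchy s t cs ct ε 0<ε =
    let B , B>0 , N₁ , hB = bounded s cs
        C , C>0 , N₂ , hC = bounded t ct
        δ , 0<δ , Bδ      = scale B B>0 ε 0<ε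
        η , 0<η , Cη      = scale C C>0 ε 0<ε
        N₃ , hs           = cs η 0<η
        N₄ , ht           = ct δ 0<δ
        N₁₂ = N₁ ℕ.⊔ N₂
        N₃₄ = N₃ ℕ.⊔ N₄
    in N₁₂ ℕ.⊔ N₃₄ , λ m n hm hn →
      let m₁₂ = ℕₚ.m⊔n≤o⇒m≤o N₁₂ N₃₄ hm ; m₃₄ = ℕₚ.m⊔n≤o⇒n≤o N₁₂ N₃₄ hm
          n₁₂ = ℕₚ.m⊔n≤o⇒m≤o N₁₂ N₃₄ hn ; n₃₄ = ℕₚ.m⊔n≤o⇒n≤o N₁₂ N₃₄ hn
      in *-close (s m) (t m) (s n) (t n) B>0 Bδ C>0 Cη
           (hB m (ℕₚ.m⊔n≤o⇒m≤o N₁ N₂ m₁₂))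
           (ht m n (ℕₚ.m⊔n≤o⇒n≤o N₃ N₄ m₃₄) (ℕₚ.m⊔n≤o⇒n≤o N₃ N₄ n₃₄))
           (hC n (ℕₚ.m⊔n≤o⇒n≤o N₁ N₂ n₁₂))
           (hs m n (ℕₚ.m⊔n≤o⇒m≤o N₃ N₄ m₃₄) (ℕₚ.m⊔n≤o⇒m≤o N₃ N₄ n₃₄))

fromℚ : ℚ → ℝ
fromℚ q = mkℝ (λ _ → q) λ ε 0<ε → 0 , λ _ _ _ _ →
  subst (ℚ._≤ ε) (sym (cong ℚ.∣_∣ (ℚₚ.+-inverseʳ q))) (ℚₚ.<⇒≤ 0<ε)

0ℝ : ℝ
0ℝ = fromℚ 0ℚ

fromℕ : ℕ → ℝ
fromℕ k = fromℚ (+ k ℚ./ 1)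

_+ℝ_ _*ℝ_ _⊔ℝ_ : ℝ → ℝ → ℝ
x +ℝ y = mkℝ (λ n → seq x n ℚ.+ seq y n) (+-cauchy (seq x) (seq y) (cauchy x) (cauchy y))
x *ℝ y = mkℝ (λ n → seq x n ℚ.* seq y n) (*-cauchy (seq x) (seq y) (cauchy x) (cauchy y))
x ⊔ℝ y = mkℝ (λ n → seq x n ℚ.⊔ seq y n) (⊔-cauchy (seq x) (seq y) (cauchy x) (cauchy y))

∑ℝ : ∀ {n} → (Fin n → ℝ) → ℝ
∑ℝ = Vector.foldr _+ℝ_ 0ℝ

IsMinimum IsMaximum : ∀ {a} {A : Set a} → (A → ℝ) → ℝ → Set a
IsMinimum f m = (∃[ a ] f a ≈ℝ m) × (∀ a → m ≤ℝ f a)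
IsMaximum f m = (∃[ a ] f a ≈ℝ m) × (∀ a → f a ≤ℝ m)

-- The values of w off the edges are junk and never used.
record WeightedGraph (n : ℕ) : Set₁ where
  infix 4 _~_ _~?_
  field
    _~_      : Rel (Fin n) 0ℓ
    _~?_     : Decidable _~_
    ~-sym    : Symmetric _~_
    ~-irrefl : Irreflexive _≡_ _~_
    w        : Fin n → Fin n → ℝ
    w-sym    : ∀ x y → w x y ≈ℝ w y x
    w-pos    : ∀ {x y} → x ~ y → 0ℝ <ℝ w x y

data Walk {a ℓ} {A : Set a} (R : Rel A ℓ) : ℕ → A → A → Set (a ⊔ ℓ) where
  []  : ∀ {x} → Walk R 0 x x
  _∷_ : ∀ {k x y z} → R x y → Walk R k y z → Walk R (suc k) x z

walk? : ∀ {n ℓ} {R : Rel (Fin n) ℓ} → Decidable R → ∀ k → Decidable (Walk R k)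
walk? R? zero    x y = map′ (λ { refl → [] }) (λ { [] → refl }) (x Finₚ.≟ y)
walk? R? (suc k) x y = map′ (λ { (_ , e , p) → e ∷ p }) (λ { (e ∷ p) → _ , e , p })
  (Finₚ.any? λ z → R? x z ×-dec walk? R? k z y)

IsLeast : ∀ {p} → Pred ℕ p → ℕ → Set p
IsLeast P m = P m × (∀ k → P k → m ℕ.≤ k)

least : ∀ {p} {P : Pred ℕ p} → (∀ k → Dec (P k)) → ∀ k → P k → ∃ (IsLeast P)
least P? zero    p = 0 , p , λ _ _ → z≤n
least P? (suc k) p with P? 0
... | yes p₀ = 0 , p₀ , λ _ _ → z≤n
... | no ¬p₀ with least (λ j → P? (suc j)) k p
...   | m , pm , min = suc m , pm ,
        λ { zero p₀ → ⊥-elim (¬p₀ p₀) ; (suc j) pj → s≤s (min j pj) }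

-- x < y selects each undirected edge once.
sumOverEdges : ∀ {n} → WeightedGraph n → (Fin n → Fin n → ℝ) → ℝ
sumOverEdges G f = ∑ℝ λ x → ∑ℝ λ y →
  if does (x Finₚ.<? y ×-dec x ~? y) then w x y *ℝ f x y else 0ℝ
  where open WeightedGraph G

module _ {n : ℕ} (G : WeightedGraph n) where
  open WeightedGraph G

  Connected : Set
  Connected = ∀ x y → ∃[ k ] Walk _~_ k x y

  ConnectedOn : Subset n → Set
  ConnectedOn S = ∀ x y → x ∈ S → y ∈ S →
    ∃[ k ] Walk (λ a b → a ∈ S × b ∈ S × a ~ b) k x y

⨆ : ∀ {n} → (Fin n → ℕ) → ℕ
⨆ = Vector.foldr ℕ._⊔_ 0

module _ {n : ℕ} (G : WeightedGraph n) (conn : Connected G) where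
  open WeightedGraph G

  shortestWalk : ∀ x y → ∃ (IsLeast λ k → Walk _~_ k x y)
  shortestWalk x y = least (λ k → walk? _~?_ k x y) (proj₁ (conn x y)) (proj₂ (conn x y))

  dist : Fin n → Fin n → ℕ
  dist x y = proj₁ (shortestWalk x y)

  diam : Subset n → ℕ
  diam S = ⨆ λ a → ⨆ λ b → if does (a ∈? S ×-dec b ∈? S) then dist a b else 0

f≤⨆f : ∀ {n} (f : Fin n → ℕ) i → f i ℕ.≤ ⨆ f
f≤⨆f f zero    = ℕₚ.m≤m⊔n _ _
f≤⨆f f (suc i) = ℕₚ.≤-trans (f≤⨆f (λ j → f (suc j)) i) (ℕₚ.m≤n⊔m (f zero) _)

element : ∀ {n} (S : Subset n) → 1 ℕ.≤ ∣ S ∣ → ∃[ x ] x ∈ S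
element (inside  ∷ S) _ = zero , Vec.here
element (outside ∷ S) h with element S h
... | x , x∈S = suc x , Vec.there x∈S

distinctElements : ∀ {n} (S : Subset n) → 2 ℕ.≤ ∣ S ∣ →
                   ∃[ x ] ∃[ y ] x ∈ S × y ∈ S × x ≢ y
distinctElements (inside ∷ S) (s≤s h) with element S h
... | y , y∈S = zero , suc y , Vec.here , Vec.there y∈S , λ ()
distinctElements (outside ∷ S) h with distinctElements S h
... | x , y , x∈S , y∈S , x≢y =
  suc x , suc y , Vec.there x∈S , Vec.there y∈S , λ eq → x≢y (Finₚ.suc-injective eq)

module _ {n : ℕ} (G : WeightedGraph n) (conn : Connected G) where
  open WeightedGraph G

  dist≤diam : ∀ S {x y} → x ∈ S → y ∈ S → dist G conn x y ℕ.≤ diam G conn S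
  dist≤diam S {x} {y} x∈S y∈S =
    ℕₚ.≤-trans (ℕₚ.≤-trans entry (f≤⨆f (row x) y)) (f≤⨆f (λ a → ⨆ (row a)) x)
    where
    row : Fin n → Fin n → ℕ
    row a b = if does (a ∈? S ×-dec b ∈? S) then dist G conn a b else 0
    entry : dist G conn x y ℕ.≤ row x y
    entry with x ∈? S | y ∈? S
    ... | yes _ | yes _ = ℕₚ.≤-refl
    ... | no x∉S | _    = ⊥-elim (x∉S x∈S)
    ... | yes _ | no y∉S = ⊥-elim (y∉S y∈S)

  dist-nonZero : ∀ {x y} → x ≢ y → 1 ℕ.≤ dist G conn x y
  dist-nonZero {x} {y} x≢y with shortestWalk G conn x y
  ... | zero  , [] , _ = ⊥-elim (x≢y refl)
  ... | suc _ , _      = s≤s z≤n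

  diam-nonZero : ∀ S → 2 ℕ.≤ ∣ S ∣ → ℕ.NonZero (diam G conn S)
  diam-nonZero S h with distinctElements S h
  ... | x , y , x∈S , y∈S , x≢y =
    ℕ.>-nonZero (ℕₚ.≤-trans (dist-nonZero x≢y) (dist≤diam S x∈S y∈S))

  record ConnectedSubset : Set where
    field
      set       : Subset n
      card≥2    : 2 ℕ.≤ ∣ set ∣
      connected : ConnectedOn G set

  ratio : ConnectedSubset → ℝ
  ratio S = fromℚ (ℚ._/_ (+ (∣ set ∣ ℕ.∸ 1)) (diam G conn set) {{diam-nonZero set card≥2}})
    where open ConnectedSubset S

  IsΓ : ℝ → Set
  IsΓ = IsMaximum ratio

-- This includes the usual triangle inequality, as distances are nonnegative.
IsUltrametric : ∀ {n} → (Fin n → Fin n → ℝ) → Set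
IsUltrametric = Metric.IsGeneralMetric _≡_ _≈ℝ_ _≤ℝ_ 0ℝ _⊔ℝ_

module _ {n : ℕ} (G : WeightedGraph n) (conn : Connected G) where

  record DominatingUltrametric : Set where
    field
      u             : Fin n → Fin n → ℝ
      isUltrametric : IsUltrametric u
      dominates     : ∀ x y → fromℕ (dist G conn x y) ≤ℝ u x y

  IsOPTfree : ℝ → Set
  IsOPTfree = IsMinimum λ U → sumOverEdges G (DominatingUltrametric.u U)

-- The order of the two children is immaterial for everything below.
record BinaryHierarchy (n : ℕ) : Set where
  field
    tree   : Tree ⊤ (Fin n)
    leaves : Leaves.toList tree ↭ allFin n

module _ {n : ℕ} where
  open DecMembership (Finₚ._≟_ {n}) using () renaming (_∈_ to _∈ₗ_; _∈?_ to _∈ₗ?_)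

  both? : (x y : Fin n) (t : Tree ⊤ (Fin n)) →
          Dec (x ∈ₗ Leaves.toList t × y ∈ₗ Leaves.toList t)
  both? x y t = x ∈ₗ? Leaves.toList t ×-dec y ∈ₗ? Leaves.toList t

  -- Leaves below the lowest common ancestor: descend as long as a child
  -- contains both vertices.
  lcaLeaves : Tree ⊤ (Fin n) → Fin n → Fin n → List (Fin n)
  lcaLeaves (leaf v) x y = v ∷ []
  lcaLeaves t@(node l _ r) x y =
    if does (both? x y l) then lcaLeaves l x y
    else if does (both? x y r) then lcaLeaves r x y
    else Leaves.toList t

  height : BinaryHierarchy n → Fin n → Fin n → ℕ
  height H x y =
    if does (x Finₚ.≟ y) then 0 else length (lcaLeaves (BinaryHierarchy.tree H) x y) ℕ.∸ 1

module _ {n : ℕ} (G : WeightedGraph n) (conn : Connected G) where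

  record DominatingHierarchy : Set where
    field
      hierarchy : BinaryHierarchy n
      dominates : ∀ x y → dist G conn x y ℕ.≤ height hierarchy x y

  IsOPTcard : ℝ → Set
  IsOPTcard = IsMinimum λ H →
    sumOverEdges G (λ x y → fromℕ (height (DominatingHierarchy.hierarchy H) x y))

{-# OPTIONS --safe #-}
module Submission where

-- Kruskal's algorithm rounds an optimal ultrametric u to a hierarchy. Start
-- from the single vertices and repeatedly merge two trees joined by an edge
-- of least u among the edges between different trees. Two facts about the
-- resulting clusters carry the proof.
--
-- Every cluster C is connected in G, since the merged trees are connected and
-- an edge joins them; so any two vertices of C are at distance at most
-- |C| - 1, and the hierarchy dominates the graph metric (dist<card).
--
-- At every stage, each tree has u-diameter at most u(x,y) for every edge xy
-- between different trees (KruskalForest.tight): a merge along pq keeps this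
-- true, since the ultrametric inequality bounds the new diameter by u(p,q)
-- and pq was a least choice (merge). Hence if C is the cluster at which an
-- edge xy is absorbed, d ≤ u gives diam C ≤ u(x,y), and connectedness of C
-- gives |C| - 1 ≤ Γ diam C ≤ Γ u(x,y) (card-1≤Γ*u). Summing over the edges
-- with weights w bounds the cost of the hierarchy by Γ times that of u.
--
-- The algorithm compares values of u, and the order of the reals is not
-- decidable. But the conclusion x ≤ y is stable under double negation
-- (≤ℝ-stable), and it is not false that finitely many reals are totally
-- ordered (¬¬-totalOn), so totality of the order on the values of u may be
-- assumed.

open import Defs
open import Data.Nat.Base as ℕ using (ℕ; zero; suc; _≤_; _<_; z≤n; s≤s)

open import Data.Bool.Base using (if_then_else_)
open import Data.Fin.Base using (Fin; zero; suc)
import Data.Fin.Properties as Finₚ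
open import Data.Fin.Subset using (Subset; _-_; ∣_∣; ⁅_⁆; ⋃) renaming (_∈_ to _∈ₛ_)
import Data.Fin.Subset.Properties as Subsetₚ
open import Data.Integer.Base as ℤ using (+_)
import Data.Integer.Properties as ℤₚ
open import Data.List.Base
  using (List; []; _∷_; _++_; length; map; allFin; concatMap; filter; cartesianProduct)
import Data.List.Extrema as Extrema
import Data.List.Membership.DecPropositional as DecMembership
open import Data.List.Membership.Propositional using (_∈_)
open import Data.List.Membership.Propositional.Properties
  using (∈-++⁺ˡ; ∈-++⁺ʳ; ∈-++⁻; ∈-allFin; ∈-filter⁺; ∈-cartesianProduct⁺)
import Data.List.Properties as Listₚ
open import Data.List.Relation.Binary.Disjoint.Propositional using (Disjoint)
open import Data.List.Relation.Binary.Permutation.Propositional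
  using (_↭_; prep; swap; ↭-refl; ↭-sym; ↭-trans; ↭-reflexive; ↭⇒↭ₛ)
open import Data.List.Relation.Binary.Permutation.Propositional.Properties
  using (All-resp-↭; Any-resp-↭; ∈-resp-↭; ↭-length; ++⁺ˡ; shifts)
import Data.List.Relation.Binary.Permutation.Setoid.Properties as Permutationₛ
open import Data.List.Relation.Unary.All as All using (All; []; _∷_)
import Data.List.Relation.Unary.All.Properties as Allₚ
open import Data.List.Relation.Unary.AllPairs using ([]; _∷_)
open import Data.List.Relation.Unary.Any as Any using (Any; here; there)
open import Data.List.Relation.Unary.Unique.Propositional using (Unique)
open import Data.List.Relation.Unary.Unique.Propositional.Properties using (allFin⁺)
import Data.Nat.Properties as ℕₚ
open import Data.Product.Base using (∃; ∃₂; ∃-syntax; _×_; _,_; proj₁; proj₂; uncurry)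
open import Data.Rational.Base as ℚ using (ℚ; 0ℚ; ½)
import Data.Rational.Properties as ℚₚ
open import Data.Rational.Solver using (module +-*-Solver)
import Data.Rational.Unnormalised.Base as ℚᵘ
import Data.Rational.Unnormalised.Properties as ℚᵘₚ
open import Data.Sum.Base using (_⊎_; inj₁; inj₂; [_,_]′)
open import Data.Tree.Binary using (Tree; leaf; node; module Leaves)
open import Data.Unit.Base using (⊤; tt)
open import Effect.Monad using (RawMonad)
open import Function.Base using (id; _∘_; _on_)
import Function.Metric.Structures as Metric
open import Level using (0ℓ)
open import Relation.Binary.Bundles using (Preorder; TotalOrder)
import Relation.Binary.Construct.On as On
open import Relation.Binary.Definitions using (Total)
open import Relation.Binary.PropositionalEquality
import Relation.Binary.Reasoning.Preorder as PreorderReasoning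
open import Relation.Nullary using (Dec; yes; no; does; ¬_; contradiction)
open import Relation.Nullary.Decidable using (_×-dec_; ¬?)
open import Relation.Nullary.Negation using (DoubleNegation; ¬¬-Monad; ¬¬-map)
open import Relation.Unary using (Pred) renaming (Decidable to Decidable₁)
open +-*-Solver using (solve; con; _:+_; _:*_; _:-_; _:=_)

if-elim : ∀ {b p q} {B : Set b} (Q : Pred B q) {P : Set p} (P? : Dec P) {x y : B} →
          (P → Q x) → (¬ P → Q y) → Q (if does P? then x else y)
if-elim Q (yes p) qx qy = qx p
if-elim Q (no ¬p) qx qy = qy ¬p

-- Order and arithmetic of Cauchy reals

≤-pointwise : ∀ {x y} → (∀ n → seq x n ℚ.≤ seq y n) → x ≤ℝ y
≤-pointwise {x} {y} x≤y ε 0<ε = 0 , λ n _ → ℚₚ.≤-trans (x≤y n)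
  (subst (ℚ._≤ seq y n ℚ.+ ε) (ℚₚ.+-identityʳ (seq y n)) (ℚₚ.+-monoʳ-≤ (seq y n) (ℚₚ.<⇒≤ 0<ε)))

≡-pointwise : ∀ {x y} → (∀ n → seq x n ≡ seq y n) → x ≤ℝ y
≡-pointwise {x} {y} x≡y = ≤-pointwise {x} {y} λ n → ℚₚ.≤-reflexive (x≡y n)

Eventually : (ℕ → Set) → Set
Eventually P = ∃[ N ] ∀ n → N ≤ n → P n

eventually₂ : ∀ {P Q R : ℕ → Set} → (∀ n → P n → Q n → R n) →
              Eventually P → Eventually Q → Eventually R
eventually₂ f (M , p) (N , q) = M ℕ.⊔ N , λ n h →
  f n (p n (ℕₚ.m⊔n≤o⇒m≤o M N h)) (q n (ℕₚ.m⊔n≤o⇒n≤o M N h))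

≤ℝ-trans : ∀ {x y z} → x ≤ℝ y → y ≤ℝ z → x ≤ℝ z
≤ℝ-trans {x} {y} {z} x≤y y≤z ε 0<ε =
  eventually₂ (λ n xy yz → ℚₚ.≤-trans xy
      (ℚₚ.≤-trans (ℚₚ.+-monoˡ-≤ (½ ℚ.* ε) yz) (ℚₚ.≤-reflexive
        (trans (ℚₚ.+-assoc (seq z n) _ _) (cong (seq z n ℚ.+_) (½+½ ε))))))
    (x≤y (½ ℚ.* ε) (0<½* 0<ε)) (y≤z (½ ℚ.* ε) (0<½* 0<ε))

≤ℝ-preorder : Preorder 0ℓ 0ℓ 0ℓ
≤ℝ-preorder = record
  { _≈_ = _≡_
  ; _≲_ = _≤ℝ_
  ; isPreorder = record
    { isEquivalence = isEquivalence
    ; reflexive = λ { {x} refl → ≡-pointwise {x} {x} λ _ → refl }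
    ; trans = λ {x} {y} {z} → ≤ℝ-trans {x} {y} {z}
    }
  }

module ≤ℝ-Reasoning = PreorderReasoning ≤ℝ-preorder

+ℝ-mono : ∀ {x x′ y y′} → x ≤ℝ x′ → y ≤ℝ y′ → x +ℝ y ≤ℝ x′ +ℝ y′
+ℝ-mono {x} {x′} {y} {y′} x≤x′ y≤y′ ε 0<ε =
  eventually₂ (λ n xx′ yy′ → ℚₚ.≤-trans (ℚₚ.+-mono-≤ xx′ yy′) (ℚₚ.≤-reflexive
      (solve 3 (λ a b e → (a :+ con ½ :* e) :+ (b :+ con ½ :* e) := (a :+ b) :+ e) refl
        (seq x′ n) (seq y′ n) ε)))
    (x≤x′ (½ ℚ.* ε) (0<½* 0<ε)) (y≤y′ (½ ℚ.* ε) (0<½* 0<ε))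

⊔ℝ-lub : ∀ {x y z} → x ≤ℝ z → y ≤ℝ z → x ⊔ℝ y ≤ℝ z
⊔ℝ-lub x≤z y≤z ε 0<ε = eventually₂ (λ n xz yz → ℚₚ.⊔-lub xz yz) (x≤z ε 0<ε) (y≤z ε 0<ε)

<⇒≤ℝ : ∀ {x y} → x <ℝ y → x ≤ℝ y
<⇒≤ℝ {x} {y} (δ , 0<δ , N , h) ε 0<ε = N , λ n N≤n →
  ℚₚ.≤-trans (below (seq x n) 0<δ) (ℚₚ.≤-trans (h n N≤n) (below (seq y n) 0<ε))
  where
  below : ∀ p {e} → 0ℚ ℚ.< e → p ℚ.≤ p ℚ.+ e
  below p {e} 0<e = subst (ℚ._≤ p ℚ.+ e) (ℚₚ.+-identityʳ p) (ℚₚ.+-monoʳ-≤ p (ℚₚ.<⇒≤ 0<e))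

<⇒≱ℝ : ∀ {x y} → x <ℝ y → ¬ y ≤ℝ x
<⇒≱ℝ {x} {y} (δ , 0<δ , x<y) y≤x =
  let N , late = eventually₂ (λ n → ℚₚ.≤-trans) x<y (y≤x (½ ℚ.* δ) (0<½* 0<δ))
  in ℚₚ.<-irrefl refl (ℚₚ.<-≤-trans (strict N) (late N ℕₚ.≤-refl))
  where
  strict : ∀ n → seq x n ℚ.+ ½ ℚ.* δ ℚ.< seq x n ℚ.+ δ
  strict n = ℚₚ.+-monoʳ-< (seq x n) (subst₂ ℚ._<_ (ℚₚ.+-identityʳ _) (½+½ δ)
    (ℚₚ.+-monoʳ-< (½ ℚ.* δ) (0<½* 0<δ)))

settled : ∀ x δ → 0ℚ ℚ.< δ → ∃[ N ] ∀ K n → N ≤ K → K ≤ n →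
          seq x n ℚ.≤ seq x K ℚ.+ δ × seq x K ℚ.≤ seq x n ℚ.+ δ
settled x δ 0<δ = let N , close = cauchy x δ 0<δ in N , λ K n N≤K K≤n →
  let N≤n = ℕₚ.≤-trans N≤K K≤n in
  ∣-∣≤⇒≤+ _ _ (close n K N≤n N≤K) , ∣-∣≤⇒≤+ _ _ (close K n N≤K N≤n)

-- Rational terms can be compared. At an index K after which both sequences
-- move by at most ε/8, the test is whether the term of x exceeds that of y by
-- at most 3ε/4. The error made by stopping at K is at most ε/4, so a positive
-- answer gives the bound with ε, and a negative one leaves a gap of ε/2.
compare : ∀ x y ε → 0ℚ ℚ.< ε →
          Eventually (λ n → seq x n ℚ.≤ seq y n ℚ.+ ε) ⊎ y <ℝ x
compare x y ε 0<ε = decide (seq x K ℚₚ.≤? seq y K ℚ.+ ¾ ℚ.* ε)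
  where
  ⅛ ¾ δ : ℚ
  ⅛ = + 1 ℚ./ 8
  ¾ = + 3 ℚ./ 4
  δ = ⅛ ℚ.* ε
  0<δ : 0ℚ ℚ.< δ
  0<δ = ℚₚ.positive⁻¹ δ {{ℚₚ.pos*pos⇒pos ⅛ ε {{ℚ.positive 0<ε}}}}
  x-settled = settled x δ 0<δ
  y-settled = settled y δ 0<δ
  K = proj₁ x-settled ℕ.⊔ proj₁ y-settled
  x-near : ∀ n → K ≤ n → _
  x-near n = proj₂ x-settled K n (ℕₚ.m≤m⊔n _ _)
  y-near : ∀ n → K ≤ n → _
  y-near n = proj₂ y-settled K n (ℕₚ.m≤n⊔m (proj₁ x-settled) _)
  chain : ∀ a b c d e → a ℚ.≤ b ℚ.+ δ → b ℚ.≤ c ℚ.+ e → c ℚ.≤ d ℚ.+ δ →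
          a ℚ.≤ ((d ℚ.+ δ) ℚ.+ e) ℚ.+ δ
  chain a b c d e ab bc cd =
    ℚₚ.≤-trans ab (ℚₚ.+-monoˡ-≤ δ (ℚₚ.≤-trans bc (ℚₚ.+-monoˡ-≤ e cd)))
  decide : Dec (seq x K ℚ.≤ seq y K ℚ.+ ¾ ℚ.* ε) →
           Eventually (λ n → seq x n ℚ.≤ seq y n ℚ.+ ε) ⊎ y <ℝ x
  decide (yes xK≤) = inj₁ (K , λ n K≤n → subst (seq x n ℚ.≤_)
    (solve 2 (λ b e → ((b :+ con ⅛ :* e) :+ con ¾ :* e) :+ con ⅛ :* e := b :+ e)
      refl (seq y n) ε)
    (chain (seq x n) (seq x K) (seq y K) (seq y n) (¾ ℚ.* ε)
      (proj₁ (x-near n K≤n)) xK≤ (proj₂ (y-near n K≤n))))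
  decide (no xK≰) = inj₂ (½ ℚ.* ε , 0<½* 0<ε , K , λ n K≤n →
    subst (seq y n ℚ.+ ½ ℚ.* ε ℚ.≤_)
      (solve 2 (λ a e → (((a :+ con ⅛ :* e) :- con ¾ :* e) :+ con ⅛ :* e) :+ con ½ :* e := a)
        refl (seq x n) ε)
      (ℚₚ.+-monoˡ-≤ (½ ℚ.* ε)
        (chain (seq y n) (seq y K) (seq x K) (seq x n) (ℚ.- (¾ ℚ.* ε))
          (proj₁ (y-near n K≤n)) (shift (ℚₚ.<⇒≤ (ℚₚ.≰⇒> xK≰))) (proj₂ (x-near n K≤n)))))
    where
    shift : seq y K ℚ.+ ¾ ℚ.* ε ℚ.≤ seq x K → seq y K ℚ.≤ seq x K ℚ.- ¾ ℚ.* ε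
    shift h = subst (ℚ._≤ seq x K ℚ.- ¾ ℚ.* ε)
      (solve 2 (λ b e → (b :+ con ¾ :* e) :- con ¾ :* e := b) refl (seq y K) ε)
      (ℚₚ.+-monoˡ-≤ (ℚ.- (¾ ℚ.* ε)) h)

-- A failure of x ≤ y at some precision would make y < x, which refutes x ≤ y.
≤ℝ-stable : ∀ {x y} → DoubleNegation (x ≤ℝ y) → x ≤ℝ y
≤ℝ-stable {x} {y} ¬¬x≤y ε 0<ε =
  [ id , (λ y<x → contradiction (<⇒≱ℝ {y} {x} y<x) ¬¬x≤y) ]′ (compare x y ε 0<ε)

-- If the order were not total at x and y, then y < x would be impossible, and
-- every precision of x ≤ y would hold.
¬¬-total : ∀ x y → DoubleNegation (x ≤ℝ y ⊎ y ≤ℝ x)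
¬¬-total x y ¬total = ¬total (inj₁ x≤y)
  where
  x≤y : x ≤ℝ y
  x≤y ε 0<ε =
    [ id , (λ y<x → contradiction (inj₂ (<⇒≤ℝ {y} {x} y<x)) ¬total) ]′ (compare x y ε 0<ε)

-- Terms of c may be slightly negative and terms of x slightly above those of
-- y. With c + δ ≥ 0 and x ≤ y + η, the error in c x ≤ c y is at most
-- η c + δ (y + η - x), and η and δ are chosen to make each summand ε/2.
*ℝ-monoˡ : ∀ {c x y} → 0ℝ ≤ℝ c → x ≤ℝ y → c *ℝ x ≤ℝ c *ℝ y
*ℝ-monoˡ {c} {x} {y} 0≤c x≤y ε 0<ε =
  eventually₂ (λ { n (c₀ , c₁) (xy , x₁ , y₁) → bound (seq c n) (seq x n) (seq y n) c₀ c₁ xy x₁ y₁ })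
    (eventually₂ (λ _ → _,_) (0≤c δ 0<δ) (proj₂ (proj₂ c-bound)))
    (eventually₂ (λ _ → _,_) (x≤y η 0<η)
      (eventually₂ (λ _ → _,_) (proj₂ (proj₂ x-bound)) (proj₂ (proj₂ y-bound))))
  where
  c-bound = bounded (seq c) (cauchy c)
  x-bound = bounded (seq x) (cauchy x)
  y-bound = bounded (seq y) (cauchy y)
  C = proj₁ c-bound
  C>0 = proj₁ (proj₂ c-bound)
  X = proj₁ x-bound
  X>0 = proj₁ (proj₂ x-bound)
  Y = proj₁ y-bound
  Y>0 = proj₁ (proj₂ y-bound)
  η-spec = scale C C>0 ε 0<ε
  η = proj₁ η-spec
  0<η = proj₁ (proj₂ η-spec)
  D = (Y ℚ.+ η) ℚ.+ X
  D>0 : ℚ.Positive D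
  D>0 = ℚₚ.pos+pos⇒pos (Y ℚ.+ η) {{ℚₚ.pos+pos⇒pos Y {{Y>0}} η {{ℚ.positive 0<η}}}} X {{X>0}}
  δ-spec = scale D D>0 ε 0<ε
  δ = proj₁ δ-spec
  0<δ = proj₁ (proj₂ δ-spec)
  bound : ∀ a b d → 0ℚ ℚ.≤ a ℚ.+ δ → ℚ.∣ a ∣ ℚ.≤ C → b ℚ.≤ d ℚ.+ η →
          ℚ.∣ b ∣ ℚ.≤ X → ℚ.∣ d ∣ ℚ.≤ Y → a ℚ.* b ℚ.≤ a ℚ.* d ℚ.+ ε
  bound a b d 0≤a+δ a≤C b≤d+η b≤X d≤Y = begin
    a ℚ.* b
      ≡⟨ solve 3 (λ a b δ → a :* b := (a :+ δ) :* b :- δ :* b) refl a b δ ⟩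
    (a ℚ.+ δ) ℚ.* b ℚ.- δ ℚ.* b
      ≤⟨ ℚₚ.+-monoˡ-≤ (ℚ.- (δ ℚ.* b)) (ℚₚ.*-monoˡ-≤-nonNeg (a ℚ.+ δ) {{ℚ.nonNegative 0≤a+δ}} b≤d+η) ⟩
    (a ℚ.+ δ) ℚ.* (d ℚ.+ η) ℚ.- δ ℚ.* b
      ≡⟨ solve 5 (λ a b d δ η → (a :+ δ) :* (d :+ η) :- δ :* b :=
                               a :* d :+ (η :* a :+ δ :* ((d :+ η) :- b))) refl a b d δ η ⟩
    a ℚ.* d ℚ.+ (η ℚ.* a ℚ.+ δ ℚ.* ((d ℚ.+ η) ℚ.- b))
      ≤⟨ ℚₚ.+-monoʳ-≤ (a ℚ.* d) (ℚₚ.+-mono-≤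
           (ℚₚ.*-monoˡ-≤-nonNeg η {{ℚ.nonNegative (ℚₚ.<⇒≤ 0<η)}} (ℚₚ.≤-trans (p≤∣p∣ a) a≤C))
           (ℚₚ.*-monoˡ-≤-nonNeg δ {{ℚ.nonNegative (ℚₚ.<⇒≤ 0<δ)}}
             (ℚₚ.+-mono-≤ (ℚₚ.+-monoˡ-≤ η (ℚₚ.≤-trans (p≤∣p∣ d) d≤Y)) -b≤X))) ⟩
    a ℚ.* d ℚ.+ (η ℚ.* C ℚ.+ δ ℚ.* D)
      ≡⟨ cong (a ℚ.* d ℚ.+_) (trans
           (cong₂ ℚ._+_ (trans (ℚₚ.*-comm η C) (proj₂ (proj₂ η-spec)))
                        (trans (ℚₚ.*-comm δ D) (proj₂ (proj₂ δ-spec))))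
           (½+½ ε)) ⟩
    a ℚ.* d ℚ.+ ε ∎
    where
    open ℚₚ.≤-Reasoning
    -b≤X : ℚ.- b ℚ.≤ X
    -b≤X = ℚₚ.≤-trans (p≤∣p∣ (ℚ.- b)) (subst (ℚ._≤ X) (sym (ℚₚ.∣-p∣≡∣p∣ b)) b≤X)

*ℝ-comm : ∀ x y → x *ℝ y ≤ℝ y *ℝ x
*ℝ-comm x y = ≡-pointwise {x *ℝ y} {y *ℝ x} λ n → ℚₚ.*-comm (seq x n) (seq y n)

*ℝ-swap : ∀ x y z → x *ℝ (y *ℝ z) ≤ℝ y *ℝ (x *ℝ z)
*ℝ-swap x y z = ≡-pointwise {x *ℝ (y *ℝ z)} {y *ℝ (x *ℝ z)} λ n →
  solve 3 (λ a b c → a :* (b :* c) := b :* (a :* c)) refl (seq x n) (seq y n) (seq z n)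

∑ℝ-scale : ∀ {n} c (f g : Fin n → ℝ) → (∀ i → f i ≤ℝ c *ℝ g i) → ∑ℝ f ≤ℝ c *ℝ ∑ℝ g
∑ℝ-scale {zero} c f g f≤cg = ≡-pointwise {0ℝ} {c *ℝ 0ℝ} λ n → sym (ℚₚ.*-zeroʳ (seq c n))
∑ℝ-scale {suc n} c f g f≤cg = begin
  f zero +ℝ ∑ℝ f′
    ≲⟨ +ℝ-mono {f zero} {c *ℝ g zero} {∑ℝ f′} {c *ℝ ∑ℝ g′} (f≤cg zero)
         (∑ℝ-scale c f′ g′ (f≤cg ∘ suc)) ⟩
  c *ℝ g zero +ℝ c *ℝ ∑ℝ g′
    ≲⟨ ≡-pointwise {c *ℝ g zero +ℝ c *ℝ ∑ℝ g′} {c *ℝ (g zero +ℝ ∑ℝ g′)}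
         (λ k → sym (ℚₚ.*-distribˡ-+ (seq c k) (seq (g zero) k) (seq (∑ℝ g′) k))) ⟩
  c *ℝ (g zero +ℝ ∑ℝ g′) ∎
  where
  open ≤ℝ-Reasoning
  f′ g′ : Fin n → ℝ
  f′ i = f (suc i)
  g′ i = g (suc i)

if-scale : ∀ {p} {P : Set p} (P? : Dec P) c {x y} → (P → x ≤ℝ c *ℝ y) →
           (if does P? then x else 0ℝ) ≤ℝ c *ℝ (if does P? then y else 0ℝ)
if-scale (yes p) c x≤cy = x≤cy p
if-scale (no _)  c x≤cy = ≡-pointwise {0ℝ} {c *ℝ 0ℝ} λ n → sym (ℚₚ.*-zeroʳ (seq c n))

/-*-cancel : ∀ a d .{{_ : ℕ.NonZero d}} → (+ a ℚ./ d) ℚ.* (+ d ℚ./ 1) ≡ + a ℚ./ 1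
/-*-cancel a d@(suc d-1) = ℚₚ.toℚᵘ-injective (begin
  ℚ.toℚᵘ ((+ a ℚ./ d) ℚ.* (+ d ℚ./ 1))
    ≈⟨ ℚₚ.toℚᵘ-homo-* (+ a ℚ./ d) (+ d ℚ./ 1) ⟩
  ℚ.toℚᵘ (+ a ℚ./ d) ℚᵘ.* ℚ.toℚᵘ (+ d ℚ./ 1)
    ≈⟨ ℚᵘₚ.*-cong (ℚₚ.toℚᵘ-fromℚᵘ (ℚᵘ.mkℚᵘ (+ a) d-1)) (ℚₚ.toℚᵘ-fromℚᵘ (ℚᵘ.mkℚᵘ (+ d) 0)) ⟩
  ℚᵘ.mkℚᵘ (+ a) d-1 ℚᵘ.* ℚᵘ.mkℚᵘ (+ d) 0
    ≈⟨ ℚᵘ.*≡* (trans (ℤₚ.*-identityʳ _) (cong (λ k → + a ℤ.* k) (cong +_ (sym (ℕₚ.*-identityʳ d))))) ⟩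
  ℚᵘ.mkℚᵘ (+ a) 0
    ≈⟨ ℚᵘₚ.≃-sym (ℚₚ.toℚᵘ-fromℚᵘ (ℚᵘ.mkℚᵘ (+ a) 0)) ⟩
  ℚ.toℚᵘ (+ a ℚ./ 1) ∎)
  where open ℚᵘₚ.≃-Reasoning

fromℕ-mono : ∀ {a b} → a ≤ b → fromℕ a ≤ℝ fromℕ b
fromℕ-mono {a} {b} a≤b = ≤-pointwise {fromℕ a} {fromℕ b} λ _ →
  ℚₚ.toℚᵘ-cancel-≤ (ℚᵘₚ.≤-respˡ-≃ (ℚᵘₚ.≃-sym (ℚₚ.toℚᵘ-fromℚᵘ (ℚᵘ.mkℚᵘ (+ a) 0)))
    (ℚᵘₚ.≤-respʳ-≃ (ℚᵘₚ.≃-sym (ℚₚ.toℚᵘ-fromℚᵘ (ℚᵘ.mkℚᵘ (+ b) 0)))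
      (ℚᵘ.*≤* (ℤₚ.*-monoʳ-≤-nonNeg (+ 1) (ℤ.+≤+ a≤b)))))

-- Lists, subsets and walks

module _ {a} {A : Set a} where

  Unique-++⁻ : ∀ (xs : List A) {ys} → Unique (xs ++ ys) → Unique xs × Unique ys × Disjoint xs ys
  Unique-++⁻ []       uniq = [] , uniq , λ ()
  Unique-++⁻ (x ∷ xs) (x∉ ∷ uniq) with Unique-++⁻ xs uniq
  ... | xs! , ys! , xs#ys = Allₚ.++⁻ˡ xs x∉ ∷ xs! , ys! ,
    λ { (here refl , v∈ys) → All.lookup (Allₚ.++⁻ʳ xs x∉) v∈ys refl
      ; (there v∈xs , v∈ys) → xs#ys (v∈xs , v∈ys) }

module _ {n : ℕ} where

  toSubset : List (Fin n) → Subset n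
  toSubset xs = ⋃ (map ⁅_⁆ xs)

  ∈-toSubset⁺ : ∀ {x xs} → x ∈ xs → x ∈ₛ toSubset xs
  ∈-toSubset⁺ (here refl) = Subsetₚ.x∈p∪q⁺ (inj₁ (Subsetₚ.x∈⁅x⁆ _))
  ∈-toSubset⁺ (there x∈)  = Subsetₚ.x∈p∪q⁺ (inj₂ (∈-toSubset⁺ x∈))

  ∈-toSubset⁻ : ∀ {x} xs → x ∈ₛ toSubset xs → x ∈ xs
  ∈-toSubset⁻ []       x∈ = contradiction x∈ Subsetₚ.∉⊥
  ∈-toSubset⁻ (y ∷ xs) x∈ with Subsetₚ.x∈p∪q⁻ ⁅ y ⁆ (toSubset xs) x∈
  ... | inj₁ x∈y = here (Subsetₚ.x∈⁅y⁆⇒x≡y y x∈y)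
  ... | inj₂ x∈xs = there (∈-toSubset⁻ xs x∈xs)

  length≤∣_∣ : ∀ (p : Subset n) {xs} → Unique xs → All (_∈ₛ p) xs → length xs ≤ ∣ p ∣
  length≤∣ p ∣ []           []          = z≤n
  length≤∣ p ∣ (x∉xs ∷ xs!) (x∈p ∷ xs⊆p) = ℕₚ.≤-trans
    (s≤s (length≤∣ p - _ ∣ xs! (All.zipWith
      (λ { (x≢y , y∈p) → Subsetₚ.x∈p∧x≢y⇒x∈p-y y∈p (x≢y ∘ sym) }) (x∉xs , xs⊆p))))
    (Subsetₚ.x∈p⇒∣p-x∣<∣p∣ x∈p)

⨆-elim : ∀ {p n} (P : Pred ℕ p) → P 0 → (f : Fin n → ℕ) → (∀ i → P (f i)) → P (⨆ f)
⨆-elim {n = zero}  P p₀ f pf = p₀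
⨆-elim {n = suc n} P p₀ f pf with ℕₚ.⊔-sel (f zero) (⨆ (λ i → f (suc i)))
... | inj₁ eq = subst P (sym eq) (pf zero)
... | inj₂ eq = subst P (sym eq) (⨆-elim P p₀ (λ i → f (suc i)) (λ i → pf (suc i)))

module _ {a r} {A : Set a} {R : A → A → Set r} where

  infixr 5 _++ʷ_
  _++ʷ_ : ∀ {j k x y z} → Walk R j x y → Walk R k y z → Walk R (j ℕ.+ k) x z
  []      ++ʷ q = q
  (e ∷ p) ++ʷ q = e ∷ (p ++ʷ q)

  mapʷ : ∀ {s} {S : A → A → Set s} → (∀ {x y} → R x y → S x y) →
         ∀ {k x y} → Walk R k x y → Walk S k x y
  mapʷ f []      = []
  mapʷ f (e ∷ p) = f e ∷ mapʷ f p

  exit : ∀ {p} {P : Pred A p} → Decidable₁ P → ∀ {k x y} → Walk R k x y → P x → ¬ P y →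
         ∃₂ λ x y → P x × ¬ P y × R x y
  exit P? []      px ¬py = contradiction px ¬py
  exit P? (_∷_ {y = z} e p) px ¬py with P? z
  ... | yes pz = exit P? p pz ¬py
  ... | no ¬pz = _ , z , px , ¬pz , e

-- Trees and forests

module _ {a} {A : Set a} where

  toList : Tree ⊤ A → List A
  toList = Leaves.toList

  toList-node : ∀ (l r : Tree ⊤ A) → toList (node l tt r) ≡ toList l ++ toList r
  toList-node l r = prepend l (toList r)
    where
    prepend : ∀ (t : Tree ⊤ A) xs → Leaves.toDiffList t xs ≡ toList t ++ xs
    prepend (leaf x)     xs = refl
    prepend (node l _ r) xs = begin
      Leaves.toDiffList l (Leaves.toDiffList r xs) ≡⟨ prepend l _ ⟩
      toList l ++ Leaves.toDiffList r xs           ≡⟨ cong (toList l ++_) (prepend r xs) ⟩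
      toList l ++ (toList r ++ xs)                 ≡⟨ Listₚ.++-assoc (toList l) _ xs ⟨
      (toList l ++ toList r) ++ xs                 ≡⟨ cong (_++ xs) (prepend l (toList r)) ⟨
      toList (node l _ r) ++ xs                    ∎
      where open ≡-Reasoning

  someLeaf : ∀ (t : Tree ⊤ A) → ∃[ x ] x ∈ toList t
  someLeaf (leaf x)     = x , here refl
  someLeaf (node l _ r) with someLeaf l
  ... | x , x∈l = x , subst (x ∈_) (sym (toList-node l r)) (∈-++⁺ˡ x∈l)

  module _ {l r : Tree ⊤ A} where

    ∈-nodeˡ : ∀ {x} → x ∈ toList l → x ∈ toList (node l tt r)
    ∈-nodeˡ x∈l = subst (_ ∈_) (sym (toList-node l r)) (∈-++⁺ˡ x∈l)

    ∈-nodeʳ : ∀ {x} → x ∈ toList r → x ∈ toList (node l tt r)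
    ∈-nodeʳ x∈r = subst (_ ∈_) (sym (toList-node l r)) (∈-++⁺ʳ (toList l) x∈r)

    ∈-node⁻ : ∀ {x} → x ∈ toList (node l tt r) → x ∈ toList l ⊎ x ∈ toList r
    ∈-node⁻ x∈ = ∈-++⁻ (toList l) (subst (_ ∈_) (toList-node l r) x∈)

  leaves : List (Tree ⊤ A) → List A
  leaves = concatMap toList

  leaves-↭ : ∀ {F F′} → F ↭ F′ → leaves F ↭ leaves F′
  leaves-↭ _↭_.refl        = ↭-refl
  leaves-↭ (prep t p)      = ++⁺ˡ (toList t) (leaves-↭ p)
  leaves-↭ (swap t t′ p)   = ↭-trans (shifts (toList t) (toList t′))
                               (++⁺ˡ (toList t′) (++⁺ˡ (toList t) (leaves-↭ p)))
  leaves-↭ (_↭_.trans p q) = ↭-trans (leaves-↭ p) (leaves-↭ q)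

  bringToFront : ∀ {x} F → x ∈ leaves F → ∃₂ λ t F′ → F ↭ t ∷ F′ × x ∈ toList t
  bringToFront (t ∷ F) x∈ with ∈-++⁻ (toList t) x∈
  ... | inj₁ x∈t = t , F , ↭-refl , x∈t
  ... | inj₂ x∈F with bringToFront F x∈F
  ...   | t′ , F′ , F↭ , x∈t′ = t′ , t ∷ F′ , ↭-trans (prep t F↭) (swap t t′ ↭-refl) , x∈t′

  Together : A → A → List (Tree ⊤ A) → Set a
  Together x y = Any λ t → x ∈ toList t × y ∈ toList t

  ∈-leaves : ∀ {x F} → Any (λ t → x ∈ toList t) F → x ∈ leaves F
  ∈-leaves {F = t ∷ _} (here x∈t)  = ∈-++⁺ˡ x∈t
  ∈-leaves {F = t ∷ _} (there x∈F) = ∈-++⁺ʳ (toList t) (∈-leaves x∈F)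

  -- Leaves are distinct, so a tree containing x is t itself, which does not
  -- contain y.
  separate : ∀ t {F x y} → Unique (leaves (t ∷ F)) → x ∈ toList t → y ∈ leaves F →
             ¬ Together x y (t ∷ F)
  separate t uniq x∈t y∈F together with Unique-++⁻ (toList t) uniq | together
  ... | _ , _ , t#F | here (_ , y∈t)   = t#F (y∈t , y∈F)
  ... | _ , _ , t#F | there together′ = t#F (x∈t , ∈-leaves (Any.map proj₁ together′))

  leaves-singletons : ∀ (xs : List A) → leaves (map leaf xs) ≡ xs
  leaves-singletons []       = refl
  leaves-singletons (x ∷ xs) = cong (x ∷_) (leaves-singletons xs)

-- Clusters and the constant Γ

module _ {n : ℕ} (G : WeightedGraph n) (conn : Connected G) where
  open WeightedGraph G

  Inside : List (Fin n) → Fin n → Fin n → Set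
  Inside xs x y = x ∈ xs × y ∈ xs × x ~ y

  0≤Γ : ∀ {Γ} → IsΓ G conn Γ → 0ℝ ≤ℝ Γ
  0≤Γ {Γ} ((S , ratio≤Γ , _) , _) = ≤ℝ-trans {0ℝ} {ratio G conn S} {Γ}
    (≤-pointwise {0ℝ} {ratio G conn S} λ _ → ℚₚ.nonNegative⁻¹ _
      {{ℚₚ.normalize-nonNeg (∣ set ∣ ℕ.∸ 1) (diam G conn set) {{diam-nonZero G conn set card≥2}}}})
    ratio≤Γ
    where open ConnectedSubset S

  diam≤ : ∀ S {v} → 0ℝ ≤ℝ v →
          (∀ {a b} → a ∈ₛ S → b ∈ₛ S → fromℕ (dist G conn a b) ≤ℝ v) →
          fromℕ (diam G conn S) ≤ℝ v
  diam≤ S {v} 0≤v dist≤v = ⨆-elim P 0≤v _ λ a → ⨆-elim P 0≤v _ λ b → entry a b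
    where
    P : ℕ → Set
    P k = fromℕ k ≤ℝ v
    entry : ∀ a b → P (if does (a Subsetₚ.∈? S ×-dec b Subsetₚ.∈? S) then dist G conn a b else 0)
    entry a b = if-elim P (a Subsetₚ.∈? S ×-dec b Subsetₚ.∈? S)
      (λ (a∈S , b∈S) → dist≤v a∈S b∈S) (λ _ → 0≤v)

  -- The definition of Γ, with the diameter replaced by any bound v on the
  -- distances.
  card-1≤Γ*v : ∀ {Γ} → IsΓ G conn Γ → ∀ {xs v} → Unique xs → 2 ≤ length xs →
    (∀ {x y} → x ∈ xs → y ∈ xs → ∃[ k ] Walk (Inside xs) k x y) →
    0ℝ ≤ℝ v → (∀ {a b} → a ∈ xs → b ∈ xs → fromℕ (dist G conn a b) ≤ℝ v) →
    fromℕ (length xs ℕ.∸ 1) ≤ℝ Γ *ℝ v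
  card-1≤Γ*v {Γ} isΓ {xs} {v} xs! 2≤xs walks 0≤v dist≤v = begin
    fromℕ (length xs ℕ.∸ 1) ≲⟨ fromℕ-mono (ℕₚ.∸-monoˡ-≤ 1 xs≤S) ⟩
    fromℕ (∣ S ∣ ℕ.∸ 1)     ≲⟨ ≡-pointwise {fromℕ (∣ S ∣ ℕ.∸ 1)} {D *ℝ ρ} (λ _ → sym (trans
                                 (ℚₚ.*-comm (+ diam G conn S ℚ./ 1) _)
                                 (/-*-cancel (∣ S ∣ ℕ.∸ 1) (diam G conn S) {{diam-nonZero G conn S 2≤S}}))) ⟩
    D *ℝ ρ                  ≲⟨ *ℝ-monoˡ {D} {ρ} {Γ} (fromℕ-mono {0} {diam G conn S} z≤n) (proj₂ isΓ cluster) ⟩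
    D *ℝ Γ                  ≲⟨ *ℝ-comm D Γ ⟩
    Γ *ℝ D                  ≲⟨ *ℝ-monoˡ {Γ} {D} {v} (0≤Γ {Γ} isΓ) (diam≤ S {v} 0≤v
                                 λ a∈ b∈ → dist≤v (∈-toSubset⁻ xs a∈) (∈-toSubset⁻ xs b∈)) ⟩
    Γ *ℝ v                  ∎
    where
    open ≤ℝ-Reasoning
    S = toSubset xs
    D = fromℕ (diam G conn S)
    xs≤S : length xs ≤ ∣ S ∣
    xs≤S = length≤∣ S ∣ xs! (All.tabulate ∈-toSubset⁺)
    2≤S = ℕₚ.≤-trans 2≤xs xs≤S
    cluster : ConnectedSubset G conn
    cluster = record
      { set = S
      ; card≥2 = 2≤S
      ; connected = λ x y x∈S y∈S →
          let k , p = walks (∈-toSubset⁻ xs x∈S) (∈-toSubset⁻ xs y∈S)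
          in k , mapʷ (λ { (a∈ , b∈ , a~b) → ∈-toSubset⁺ a∈ , ∈-toSubset⁺ b∈ , a~b }) p
      }
    ρ = ratio G conn cluster

  dist≤walk : ∀ {k x y} → Walk _~_ k x y → dist G conn x y ≤ k
  dist≤walk {k} {x} {y} p = proj₂ (proj₂ (shortestWalk G conn x y)) k p

  TotalOn : (Fin n → Fin n → ℝ) → Set
  TotalOn u = Total (_≤ℝ_ on uncurry u)

  -- Kruskal's algorithm on the edge lengths u

  module Kruskal {u : Fin n → Fin n → ℝ} (isUltrametric : IsUltrametric u) (total : TotalOn u) where

    private module U = Metric.IsGeneralMetric isUltrametric

    open DecMembership (Finₚ._≟_ {n}) using (_∈?_)

    Spread : List (Fin n) → ℝ → Set
    Spread xs v = ∀ {a b} → a ∈ xs → b ∈ xs → u a b ≤ℝ v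

    -- A merge history: p ~ q is the edge along which a merge was made, and each
    -- edge absorbed by it is at least as long as the u-diameter of the result.
    data KruskalTree : Tree ⊤ (Fin n) → Set where
      leaf : ∀ v → KruskalTree (leaf v)
      node : ∀ {l r p q} → KruskalTree l → KruskalTree r →
             p ∈ toList l → q ∈ toList r → p ~ q →
             (∀ {x y} → x ∈ toList l → y ∈ toList r → x ~ y →
                Spread (toList (node l tt r)) (u x y)) →
             KruskalTree (node l tt r)

    Crossing : List (Tree ⊤ (Fin n)) → Fin n × Fin n → Set
    Crossing F (x , y) = x ~ y × ¬ Together x y F

    crossing? : ∀ F → Decidable₁ (Crossing F)
    crossing? F (x , y) = (x ~? y) ×-dec ¬? (Any.any? (both? x y) F)

    record KruskalForest (F : List (Tree ⊤ (Fin n))) : Set where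
      field
        covers : leaves F ↭ allFin n
        trees  : All KruskalTree F
        tight  : ∀ {x y} → Crossing F (x , y) → All (λ t → Spread (toList t) (u x y)) F

      unique : Unique (leaves F)
      unique = Permutationₛ.Unique-resp-↭ (setoid (Fin n)) (↭⇒↭ₛ (↭-sym covers)) (allFin⁺ n)

      covered : ∀ x → x ∈ leaves F
      covered x = ∈-resp-↭ (↭-sym covers) (∈-allFin x)

    open KruskalForest

    reorder : ∀ {F F′} → F ↭ F′ → KruskalForest F → KruskalForest F′
    reorder F↭F′ K = record
      { covers = ↭-trans (leaves-↭ (↭-sym F↭F′)) (covers K)
      ; trees  = All-resp-↭ F↭F′ (trees K)
      ; tight  = λ { (x~y , apart) → All-resp-↭ F↭F′ (tight K (x~y , apart ∘ Any-resp-↭ F↭F′)) }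
      }

    edgeOrder : TotalOrder 0ℓ 0ℓ 0ℓ
    edgeOrder = record
      { _≈_ = _≈ℝ_ on uncurry u
      ; _≤_ = _≤ℝ_ on uncurry u
      ; isTotalOrder = record
        { isPartialOrder = On.isPartialOrder (uncurry u) U.isPartialOrder
        ; total = total
        }
      }

    open Extrema edgeOrder using (min; min≤xs; argmin-all)

    cheapest : ∀ F {e} → Crossing F e →
      ∃₂ λ p q → Crossing F (p , q) × (∀ {x y} → Crossing F (x , y) → u p q ≤ℝ u x y)
    cheapest F {e} e-crosses = proj₁ m , proj₂ m
      , argmin-all id e-crosses (Allₚ.all-filter (crossing? F) pairs)
      , λ {x} {y} crosses → All.lookup (min≤xs e candidates)
          (∈-filter⁺ (crossing? F) (∈-cartesianProduct⁺ (∈-allFin x) (∈-allFin y)) crosses)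
      where
      pairs candidates : List (Fin n × Fin n)
      pairs = cartesianProduct (allFin n) (allFin n)
      candidates = filter (crossing? F) pairs
      m = min e candidates

    -- A walk from t to t′ has to leave t.
    crossing-exists : ∀ {t t′ F} → KruskalForest (t ∷ t′ ∷ F) → ∃ (Crossing (t ∷ t′ ∷ F))
    crossing-exists {t} {t′} {F} K =
      let a , a∈t = someLeaf t
          b , b∈t′ = someLeaf t′
          _ , _ , t#F = Unique-++⁻ (toList t) (unique K)
          x , y , x∈t , y∉t , x~y = exit (_∈? toList t) (proj₂ (conn a b)) a∈t
                                      (λ b∈t → t#F (b∈t , ∈-++⁺ˡ b∈t′))
          y∈F = [ (λ y∈t → contradiction y∈t y∉t) , id ]′ (∈-++⁻ (toList t) (covered K y))
      in (x , y) , x~y , separate t (unique K) x∈t y∈F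

    endTrees : ∀ {F p q} → KruskalForest F → ¬ Together p q F →
      ∃[ l ] ∃[ r ] ∃[ F′ ] F ↭ l ∷ r ∷ F′ × p ∈ toList l × q ∈ toList r
    endTrees {F} {p} {q} K apart with bringToFront F (covered K p)
    ... | l , F₁ , F↭ , p∈l with ∈-++⁻ (toList l) (covered (reorder F↭ K) q)
    ...   | inj₁ q∈l = contradiction (Any-resp-↭ (↭-sym F↭) (here (p∈l , q∈l))) apart
    ...   | inj₂ q∈F₁ with bringToFront F₁ q∈F₁
    ...     | r , F₂ , F₁↭ , q∈r = l , r , F₂ , ↭-trans F↭ (prep l F₁↭) , p∈l , q∈r

    -- The ultrametric inequality along the path a, p, q, b.
    merged-spread : ∀ {l r p q} → p ∈ toList l → q ∈ toList r →
      Spread (toList l) (u p q) → Spread (toList r) (u p q) → Spread (toList (node l tt r)) (u p q)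
    merged-spread {l} {r} {p} {q} p∈l q∈r l≤ r≤ {a} {b} a∈ b∈ =
      go (∈-node⁻ {l = l} {r} a∈) (∈-node⁻ {l = l} {r} b∈)
      where
      across : ∀ {a b} → a ∈ toList l → b ∈ toList r → u a b ≤ℝ u p q
      across {a} {b} a∈l b∈r = begin
        u a b          ≲⟨ U.triangle a p b ⟩
        u a p ⊔ℝ u p b ≲⟨ ⊔ℝ-lub {u a p} {u p b} {u p q} (l≤ a∈l p∈l) (begin
          u p b          ≲⟨ U.triangle p q b ⟩
          u p q ⊔ℝ u q b ≲⟨ ⊔ℝ-lub {u p q} {u q b} {u p q} (Preorder.refl ≤ℝ-preorder {u p q}) (r≤ q∈r b∈r) ⟩
          u p q          ∎) ⟩
        u p q          ∎
        where open ≤ℝ-Reasoning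
      go : a ∈ toList l ⊎ a ∈ toList r → b ∈ toList l ⊎ b ∈ toList r → u a b ≤ℝ u p q
      go (inj₁ a∈l) (inj₁ b∈l) = l≤ a∈l b∈l
      go (inj₁ a∈l) (inj₂ b∈r) = across a∈l b∈r
      go (inj₂ a∈r) (inj₁ b∈l) = U.trans {u a b} {u b a} {u p q} (proj₁ (U.sym a b)) (across b∈l a∈r)
      go (inj₂ a∈r) (inj₂ b∈r) = r≤ a∈r b∈r

    -- An edge that crosses after the merge crossed before, so it is at least as
    -- long as p ~ q, which bounds the spread of the new tree. The same holds
    -- for the edges absorbed by the merge.
    merge : ∀ {l r F p q} → KruskalForest (l ∷ r ∷ F) → p ∈ toList l → q ∈ toList r → p ~ q →
      (∀ {x y} → Crossing (l ∷ r ∷ F) (x , y) → u p q ≤ℝ u x y) →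
      KruskalForest (node l tt r ∷ F)
    merge {l} {r} {F} {p} {q} K p∈l q∈r p~q pq-least with trees K
    ... | kl ∷ kr ∷ ks = record
      { covers = ↭-trans (↭-reflexive (trans (cong (_++ leaves F) (toList-node l r))
                                             (Listₚ.++-assoc (toList l) (toList r) (leaves F))))
                         (covers K)
      ; trees  = node kl kr p∈l q∈r p~q
                   (λ x∈l y∈r x~y → widen (x~y , separate l (unique K) x∈l (∈-++⁺ˡ y∈r))) ∷ ks
      ; tight  = λ { (x~y , apart) → let crosses = x~y , apart ∘ coarsen in
                   widen crosses ∷ All.tail (All.tail (tight K crosses)) }
      }
      where
      coarsen : ∀ {x y} → Together x y (l ∷ r ∷ F) → Together x y (node l tt r ∷ F)
      coarsen (here (x∈l , y∈l))         = here (∈-nodeˡ {l = l} {r} x∈l , ∈-nodeˡ {l = l} {r} y∈l)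
      coarsen (there (here (x∈r , y∈r))) = here (∈-nodeʳ {l = l} {r} x∈r , ∈-nodeʳ {l = l} {r} y∈r)
      coarsen (there (there together))   = there together
      l,r-spread = tight K (p~q , separate l (unique K) p∈l (∈-++⁺ˡ q∈r))
      widen : ∀ {x y} → Crossing (l ∷ r ∷ F) (x , y) → Spread (toList (node l tt r)) (u x y)
      widen {x} {y} crosses {a} {b} a∈ b∈ = U.trans {u a b} {u p q} {u x y}
        (merged-spread {l} {r} {p} {q} p∈l q∈r
          (All.head l,r-spread) (All.head (All.tail l,r-spread)) a∈ b∈)
        (pq-least crosses)

    build : ∀ k {F} → length F ≡ suc k → KruskalForest F → ∃[ T ] KruskalForest (T ∷ [])
    build zero    {T ∷ []}     eq K = T , K
    build (suc k) {F@(_ ∷ _ ∷ _)} eq K =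
      let _ , crosses = crossing-exists K
          p , q , (p~q , apart) , least = cheapest F crosses
          l , r , F′ , F↭ , p∈l , q∈r = endTrees K apart
      in build k (trans (sym (ℕₚ.suc-injective (↭-length F↭))) (ℕₚ.suc-injective eq))
           (merge (reorder F↭ K) p∈l q∈r p~q
             (λ { (x~y , apart′) → least (x~y , apart′ ∘ Any-resp-↭ F↭) }))

    singletons : KruskalForest (map leaf (allFin n))
    singletons = record
      { covers = ↭-reflexive (leaves-singletons (allFin n))
      ; trees  = Allₚ.map⁺ (All.universal leaf (allFin n))
      ; tight  = λ {x} {y} _ → Allₚ.map⁺ (All.universal
          (λ v → λ { {a} (here refl) (here refl) →
            U.trans {u a a} {0ℝ} {u x y} (proj₁ (U.≈⇒0 refl)) U.nonNegative }) (allFin n))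
      }

    kruskal : 2 ≤ n → ∃[ T ] KruskalForest (T ∷ [])
    kruskal (s≤s {n = k} _) = build k
      (trans (Listₚ.length-map leaf (allFin n)) (Listₚ.length-tabulate id)) singletons

    -- Clusters of a Kruskal tree

    -- A walk between the two subtrees consists of j < |l| edges in l, the
    -- merging edge and k < |r| edges in r, and j + 1 + k < |l| + |r|.
    walkInside : ∀ {t} → KruskalTree t → ∀ {x y} → x ∈ toList t → y ∈ toList t →
      ∃[ k ] k < length (toList t) × Walk (Inside (toList t)) k x y
    walkInside (leaf v) (here refl) (here refl) = 0 , s≤s z≤n , []
    walkInside (node {l} {r} {p} {q} kl kr p∈l q∈r p~q _) {x} {y} x∈ y∈
      = go (∈-node⁻ {l = l} {r} x∈) (∈-node⁻ {l = l} {r} y∈)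
      where
      W = Walk (Inside (toList (node l tt r)))
      len : length (toList (node l tt r)) ≡ length (toList l) ℕ.+ length (toList r)
      len = trans (cong length (toList-node l r)) (Listₚ.length-++ (toList l))
      inl : ∀ {a b} → Inside (toList l) a b → Inside (toList (node l tt r)) a b
      inl (a∈ , b∈ , a~b) = ∈-nodeˡ {l = l} {r} a∈ , ∈-nodeˡ {l = l} {r} b∈ , a~b
      inr : ∀ {a b} → Inside (toList r) a b → Inside (toList (node l tt r)) a b
      inr (a∈ , b∈ , a~b) = ∈-nodeʳ {l = l} {r} a∈ , ∈-nodeʳ {l = l} {r} b∈ , a~b
      go : x ∈ toList l ⊎ x ∈ toList r → y ∈ toList l ⊎ y ∈ toList r →
           ∃[ k ] k < length (toList (node l tt r)) × W k x y
      go (inj₁ x∈l) (inj₁ y∈l) = let k , k< , w = walkInside kl x∈l y∈l in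
        k , subst (k <_) (sym len) (ℕₚ.<-≤-trans k< (ℕₚ.m≤m+n _ _)) , mapʷ inl w
      go (inj₂ x∈r) (inj₂ y∈r) = let k , k< , w = walkInside kr x∈r y∈r in
        k , subst (k <_) (sym len) (ℕₚ.<-≤-trans k< (ℕₚ.m≤n+m _ _)) , mapʷ inr w
      go (inj₁ x∈l) (inj₂ y∈r) =
        let j , j< , v = walkInside kl x∈l p∈l
            k , k< , w = walkInside kr q∈r y∈r
        in j ℕ.+ suc k , subst (j ℕ.+ suc k <_) (sym len) (ℕₚ.+-mono-≤ j< k<)
           , mapʷ inl v ++ʷ (∈-nodeˡ {l = l} {r} p∈l , ∈-nodeʳ {l = l} {r} q∈r , p~q) ∷ mapʷ inr w
      go (inj₂ x∈r) (inj₁ y∈l) =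
        let j , j< , v = walkInside kr x∈r q∈r
            k , k< , w = walkInside kl p∈l y∈l
        in j ℕ.+ suc k , subst (j ℕ.+ suc k <_) (trans (ℕₚ.+-comm (length (toList r)) _) (sym len)) (ℕₚ.+-mono-≤ j< k<)
           , mapʷ inr v ++ʷ (∈-nodeʳ {l = l} {r} q∈r , ∈-nodeˡ {l = l} {r} p∈l , ~-sym p~q) ∷ mapʷ inl w

    -- The list is an index, so that matching on split replaces the computed
    -- list of leaves by those of the node at which x and y part.
    data LcaCluster (x y : Fin n) : List (Fin n) → Set where
      split : ∀ {l r} → KruskalTree (node l tt r) → Unique (toList (node l tt r)) →
              (x ∈ toList l × y ∈ toList r) ⊎ (x ∈ toList r × y ∈ toList l) →
              LcaCluster x y (toList (node l tt r))

    lca : ∀ {T x y} → KruskalTree T → Unique (toList T) → x ≢ y →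
          x ∈ toList T → y ∈ toList T → LcaCluster x y (lcaLeaves T x y)
    lca (leaf v) _ x≢y (here refl) (here refl) = contradiction refl x≢y
    lca {T} {x} {y} k@(node {l} {r} kl kr _ _ _ _) T! x≢y x∈ y∈ =
      go (both? x y l) (both? x y r)
      where
      parts = Unique-++⁻ (toList l) (subst Unique (toList-node l r) T!)
      go : (l? : Dec (x ∈ toList l × y ∈ toList l)) (r? : Dec (x ∈ toList r × y ∈ toList r)) →
           LcaCluster x y (if does l? then lcaLeaves l x y
                           else if does r? then lcaLeaves r x y else toList T)
      go (yes (x∈l , y∈l)) _ = lca kl (proj₁ parts) x≢y x∈l y∈l
      go (no _) (yes (x∈r , y∈r)) = lca kr (proj₁ (proj₂ parts)) x≢y x∈r y∈r
      go (no ¬l) (no ¬r) with ∈-node⁻ {l = l} {r} x∈ | ∈-node⁻ {l = l} {r} y∈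
      ... | inj₁ x∈l | inj₂ y∈r = split k T! (inj₁ (x∈l , y∈r))
      ... | inj₂ x∈r | inj₁ y∈l = split k T! (inj₂ (x∈r , y∈l))
      ... | inj₁ x∈l | inj₁ y∈l = contradiction (x∈l , y∈l) ¬l
      ... | inj₂ x∈r | inj₂ y∈r = contradiction (x∈r , y∈r) ¬r

    ends : ∀ {x y xs} → LcaCluster x y xs → x ∈ xs × y ∈ xs
    ends (split {l} {r} _ _ (inj₁ (x∈l , y∈r))) = ∈-nodeˡ {l = l} {r} x∈l , ∈-nodeʳ {l = l} {r} y∈r
    ends (split {l} {r} _ _ (inj₂ (x∈r , y∈l))) = ∈-nodeʳ {l = l} {r} x∈r , ∈-nodeˡ {l = l} {r} y∈l

    dist<card : ∀ {x y xs} → LcaCluster x y xs → dist G conn x y < length xs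
    dist<card c@(split k _ _) =
      let x∈ , y∈ = ends c
          j , j< , w = walkInside k x∈ y∈
      in ℕₚ.≤-<-trans (dist≤walk (mapʷ (proj₂ ∘ proj₂) w)) j<

    -- The edge x ~ y is absorbed when the cluster is formed, so the cluster has
    -- u-diameter, hence diameter in the graph metric, at most u x y.
    card-1≤Γ*u : (∀ x y → fromℕ (dist G conn x y) ≤ℝ u x y) → ∀ {Γ} → IsΓ G conn Γ →
      ∀ {x y xs} → x ~ y → LcaCluster x y xs → fromℕ (length xs ℕ.∸ 1) ≤ℝ Γ *ℝ u x y
    card-1≤Γ*u dist≤u {Γ} isΓ {x} {y} x~y c@(split {l} {r} k@(node _ _ _ _ _ spread) c! sides) =
      card-1≤Γ*v {Γ} isΓ {v = u x y} c!
        (ℕₚ.≤-trans (s≤s (dist-nonZero G conn (λ x≡y → ~-irrefl x≡y x~y))) (dist<card c))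
        (λ a∈ b∈ → let j , _ , w = walkInside k a∈ b∈ in j , w)
        U.nonNegative
        (λ {a} {b} a∈ b∈ → U.trans {fromℕ (dist G conn a b)} {u a b} {u x y} (dist≤u a b) (cluster≤ sides a∈ b∈))
      where
      cluster≤ : (x ∈ toList l × y ∈ toList r) ⊎ (x ∈ toList r × y ∈ toList l) →
                 Spread (toList (node l tt r)) (u x y)
      cluster≤ (inj₁ (x∈l , y∈r)) a∈ b∈ = spread x∈l y∈r x~y a∈ b∈
      cluster≤ (inj₂ (x∈r , y∈l)) {a} {b} a∈ b∈ =
        U.trans {u a b} {u y x} {u x y} (spread y∈l x∈r (~-sym x~y) a∈ b∈) (proj₁ (U.sym y x))

  -- Rounding an ultrametric to a hierarchy

  record Rounding (u : Fin n → Fin n → ℝ) (Γ : ℝ) : Set where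
    field
      hierarchy : DominatingHierarchy G conn
      height≤   : ∀ {x y} → x ~ y →
        fromℕ (height (DominatingHierarchy.hierarchy hierarchy) x y) ≤ℝ Γ *ℝ u x y

  ¬¬-totalOn : ∀ u → DoubleNegation (TotalOn u)
  ¬¬-totalOn u = ¬¬-map (λ total (x , y) (z , w) → total x y z w)
    (choose λ x → choose λ y → choose λ z → choose λ w → ¬¬-total (u x y) (u z w))
    where
    choose : ∀ {n} {P : Fin n → Set} → (∀ i → DoubleNegation (P i)) → DoubleNegation (∀ i → P i)
    choose = Finₚ.sequence (RawMonad.rawApplicative ¬¬-Monad)

  round : ∀ (U : DominatingUltrametric G conn) {Γ} → IsΓ G conn Γ → 2 ≤ n →
          TotalOn (DominatingUltrametric.u U) → Rounding (DominatingUltrametric.u U) Γ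
  round U {Γ} isΓ 2≤n total = record { hierarchy = H ; height≤ = height≤ }
    where
    open DominatingUltrametric U
    open Kruskal isUltrametric total
    T = proj₁ (kruskal 2≤n)
    K = proj₂ (kruskal 2≤n)
    leaves≡ : leaves (T ∷ []) ≡ toList T
    leaves≡ = Listₚ.++-identityʳ (toList T)
    hierarchy : BinaryHierarchy n
    hierarchy = record { tree = T ; leaves = subst (_↭ allFin n) leaves≡ (KruskalForest.covers K) }
    cluster : ∀ {x y} → x ≢ y → LcaCluster x y (lcaLeaves T x y)
    cluster x≢y = lca (All.head (KruskalForest.trees K)) (subst Unique leaves≡ (KruskalForest.unique K)) x≢y
      (subst (_ ∈_) leaves≡ (KruskalForest.covered K _)) (subst (_ ∈_) leaves≡ (KruskalForest.covered K _))
    H : DominatingHierarchy G conn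
    H = record { hierarchy = hierarchy ; dominates = dominated }
      where
      dominated : ∀ x y → dist G conn x y ≤ height hierarchy x y
      dominated x y = if-elim (dist G conn x y ≤_) (x Finₚ.≟ y)
        (λ { refl → dist≤walk [] })
        (λ x≢y → ℕₚ.∸-monoˡ-≤ 1 (dist<card (cluster x≢y)))
    height≤ : ∀ {x y} → x ~ y → fromℕ (height hierarchy x y) ≤ℝ Γ *ℝ u x y
    height≤ {x} {y} x~y = if-elim (λ k → fromℕ k ≤ℝ Γ *ℝ u x y) (x Finₚ.≟ y)
      (λ x≡y → contradiction x~y (~-irrefl x≡y))
      (λ x≢y → card-1≤Γ*u dominates {Γ} isΓ x~y (cluster x≢y))

  sumOverEdges-scale : ∀ c {f g : Fin n → Fin n → ℝ} →
    (∀ {x y} → x ~ y → f x y ≤ℝ c *ℝ g x y) → sumOverEdges G f ≤ℝ c *ℝ sumOverEdges G g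
  sumOverEdges-scale c {f} {g} f≤cg = ∑ℝ-scale c _ _ λ x → ∑ℝ-scale c _ _ λ y →
    if-scale (x Finₚ.<? y ×-dec x ~? y) c {w x y *ℝ f x y} {w x y *ℝ g x y} λ (_ , x~y) → begin
      w x y *ℝ f x y          ≲⟨ *ℝ-monoˡ {w x y} {f x y} {c *ℝ g x y}
                                   (<⇒≤ℝ {0ℝ} {w x y} (w-pos x~y)) (f≤cg x~y) ⟩
      w x y *ℝ (c *ℝ g x y)   ≲⟨ *ℝ-swap (w x y) c (g x y) ⟩
      c *ℝ (w x y *ℝ g x y)   ∎
    where open ≤ℝ-Reasoning

corollary21 : ∀ (n : ℕ) → 2 ≤ n →
    (G : WeightedGraph n) (conn : Connected G)
    (Γ optCard optFree : ℝ) →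
    IsΓ G conn Γ →
    IsOPTcard G conn optCard →
    IsOPTfree G conn optFree →
    optCard ≤ℝ Γ *ℝ optFree
corollary21 n 2≤n G conn Γ optCard optFree isΓ (_ , card-min) ((U , costU≈ , _) , _) =
  ≤ℝ-stable {optCard} {Γ *ℝ optFree} (¬¬-map bound (¬¬-totalOn G conn u))
  where
  open DominatingUltrametric U
  bound : TotalOn G conn u → optCard ≤ℝ Γ *ℝ optFree
  bound total = begin
    optCard       ≲⟨ card-min hierarchy ⟩
    cost h        ≲⟨ sumOverEdges-scale G conn Γ {h} {u} height≤ ⟩
    Γ *ℝ cost u   ≲⟨ *ℝ-monoˡ {Γ} {cost u} {optFree} (0≤Γ G conn {Γ} isΓ) costU≈ ⟩
    Γ *ℝ optFree  ∎
    where
    open ≤ℝ-Reasoning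
    open Rounding (round G conn U {Γ} isΓ 2≤n total)
    cost = sumOverEdges G
    h : Fin n → Fin n → ℝ
    h x y = fromℕ (height (DominatingHierarchy.hierarchy hierarchy) x y)
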